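{- In the axiom system $\mathtt{TMM}$, the scheme $\mathtt{spec}$ cannot be weakened by adding any disjoint variable condition: the scheme $\mathtt{spec}$ (i.e. $\forall x\,\phi\to\phi$ without disjoint variable conditions) is not provable from the set of schemes consisting of $\mathtt{TMM}\setminus\{\mathtt{spec}\}$ together with the scheme $(\forall x\,\phi\to\phi,\ \{\{x,\phi\}\})$. In particular, $\mathtt{spec}$ is independent in $\mathtt{TMM}$.
   Context: **Metavariables and metaformulas.** Let $\mathrm{vrMV}=\{x_i\mid i\in\omega\}$ (variable metavariables) and $\mathrm{fmMV}=\{\phi_i\mid i\in\omega\}$ (formula metavariables) be disjoint countably infinite sets of symbols, and $\mathrm{MV}=\mathrm{vrMV}\cup\mathrm{fmMV}$. A language $\mathcal L$ is a set of further symbols (nonlogical predicates) with an arity function $\mathcal L\to\omega$. Fix a language $\mathcal L$. A metaformula is one of: a formula metavariable; $x_i\equiv x_j$; $P(x_{i_1},\dots,x_{i_r})$ with $P\in\mathcal L$ of arity $r$; $\forall x_i\,\Phi$; $\neg\Phi$; $\Phi\to\Psi$, where $\Phi,\Psi$ are metaformulas. $\mathrm{MF}$ is the set of metaformulas. $\mathrm{OC}(\Phi)\subseteq\mathrm{MV}$ is the set of metavariables occurring in $\Phi$ (including those directly after a quantifier), and $\mathrm{OC}(x_i)=\{x_i\}$. For a set $X$, $\mathcal P_2(X)$ is the set of its two-element subsets. **Schemes.** A scheme $\Phi=(\{\Phi_1,\dots,\Phi_n\},\Phi_0,\mathrm{DV}(\Phi))$ consists of a finite set of metaformulas (hypotheses),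 a metaformula (conclusion), and a set $\mathrm{DV}(\Phi)\subseteq\mathcal P_2(\mathrm{OC}(\Phi))$ (disjoint variable conditions), where $\mathrm{OC}(\Phi)$ is the set of metavariables occurring in its hypotheses or conclusion. Writing $(\Phi_I,\Phi_0,D)$ with a larger $D$ means that $D$ is intersected with $\mathcal P_2(\mathrm{OC}(\Phi))$. Such a scheme is displayed as $\Phi_1\;\&\;\dots\;\&\;\Phi_n\Longrightarrow\Phi_0,\ \mathrm{DV}(\cdot,\cdot),\dots$, where $\mathrm{DV}(m,n)$ denotes the condition $\{m,n\}$; a scheme without hypotheses is written $(\Phi_0,\mathrm{DV}(\Phi))$. **Substitution and instances.** A substitution is a map $\sigma:\mathrm{MV}\to\mathrm{vrMV}\cup\mathrm{MF}$ with $\sigma(\mathrm{vrMV})\subseteq\mathrm{vrMV}$, $\sigma(\mathrm{fmMV})\subseteq\mathrm{MF}$ and $\sigma(m)=m$ for all but finitely many $m$. $\Phi^\sigma$ is the result of simultaneous plain substitution in the metaformula $\Phi$ (variable metavariables after quantifiers are also replaced). For $D\subseteq\mathcal P_2(\mathrm{MV})$, $D^\sigma=\{\{m,n\}\in\mathcal P_2(\mathrm{MV})\mid\exists\{m',n'\}\in D,\ m\in\mathrm{OC}(\sigma(m')),\ n\in\mathrm{OC}(\sigma(n'))\}$. $\sigma$ is legitimate on a scheme $\Phi$ if $\{m,n\}\in\mathrm{DV}(\Phi)$ implies $\mathrm{OC}(\sigma(m))\cap\mathrm{OC}(\sigma(n))=\varnothing$. A scheme $\Psi$ is an instance of $\Phi$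 if for some $\sigma$ legitimate on $\Phi$ the hypotheses and conclusion of $\Psi$ are the images under $\sigma$ of those of $\Phi$ and $\mathrm{DV}(\Phi)^\sigma\subseteq\mathrm{DV}(\Psi)$. **Proofs.** A proof of a scheme $\Phi$ from a set of schemes $S$ is a finite sequence $P$ of metaformulas (lines) whose last line is the conclusion of $\Phi$ and such that each line $P_i$ that is not a hypothesis of $\Phi$ admits $i_1,\dots,i_n<i$ for which $(\{P_{i_1},\dots,P_{i_n}\},P_i,\mathrm{DV}(P))$ is an instance of a scheme in $S$, where $\mathrm{DV}(P)=\mathrm{DV}(\Phi)\cup\{\{m,n\}\mid m\in\mathrm{OC}(P)\setminus\mathrm{OC}(\Phi),\ n\in\mathrm{OC}(P),\ m\ne n\}$ and $\mathrm{OC}(P)$ is the set of metavariables occurring in the lines of $P$ (or in $\Phi$). $\Phi$ is provable from $S$ if such a proof exists. A scheme is independent in a set of schemes containing it if it is not provable from the other schemes of that set. (Provability does not depend on the choice of the language containing the symbols involved.) **The system $\mathtt{TMM}$.** With $x,y,z$ distinct variable metavariables and $\phi,\psi,\chi,\theta,\tau$ distinct formula metavariables, $\mathtt{TMM}$ is the set of the following schemes: - $\mathtt{mp}$: $\phi\;\&\;\phi\to\psi\Longrightarrow\psi$ - $\mathtt{minimp}$: $\phi\to((\psi\to\chi)\to(((\theta\to\psi)\to(\chi\to\tau))\to(\psi\to\tau)))$ - $\mathtt{peirce}$: $((\phi\to\psi)\to\phi)\to\phi$ - $\mathtt{contrap}$: $(\phi\to\neg\psi)\to(\psi\to\neg\phi)$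 - $\mathtt{notelim}$: $\neg\phi\to(\phi\to\psi)$ - $\mathtt{gen}$: $\phi\Longrightarrow\forall x\,\phi$ - $\mathtt{ALLdistr}$: $\forall x(\phi\to\psi)\to(\forall x\,\phi\to\forall x\,\psi)$ - $\mathtt{spec}$: $\forall x\,\phi\to\phi$ - $\mathtt{modal5}$: $\neg\forall x\,\phi\to\forall x\,\neg\forall x\,\phi$ - $\mathtt{vacGen}$: $\phi\to\forall x\,\phi,\ \mathrm{DV}(x,\phi)$ - $\mathtt{ALLcomm}$: $\forall x\forall y\,\phi\to\forall y\forall x\,\phi$ - $\mathtt{EQrefl}$: $x\equiv x$ - $\mathtt{EQsymm}$: $x\equiv y\to y\equiv x$ - $\mathtt{EQtrans}$: $x\equiv y\to(y\equiv z\to x\equiv z)$ - $\mathtt{denot}$: $x\equiv x\to\neg\forall y\,\neg\,y\equiv x,\ \mathrm{DV}(x,y)$ - $\mathtt{subst}$: $\forall x(x\equiv y\to(\phi\to\forall x(x\equiv y\to\phi))),\ \mathrm{DV}(x,y),\ \mathrm{DV}(y,\phi)$ - $\mathtt{ALLeq}$: $\forall x\,x\equiv y\to(\forall x\,\phi\to\forall y\,\phi)$ - $\mathtt{genEq}$: $\neg\forall x\,x\equiv y\to(\neg\forall x\,x\equiv z\to(y\equiv z\to\forall x\,y\equiv z))$ -}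

module Defs where

open import Data.Empty using (⊥)
open import Data.Fin.Base using (Fin; _<_)
open import Data.List.Base using (List; []; _∷_; _++_; map; concatMap)
open import Data.List.Membership.Propositional using (_∈_; _∉_)
open import Data.List.Relation.Binary.BagAndSetEquality using (_∼[_]_; set)
open import Data.List.Relation.Binary.Disjoint.Propositional using (Disjoint)
open import Data.List.Relation.Unary.All using (All)
open import Data.Nat.Base using (ℕ; suc)
open import Data.Product.Base using (∃-syntax; _×_; _,_)
open import Data.Sum.Base as Sum using (_⊎_; inj₁; inj₂)
open import Data.Vec.Base as Vec using (Vec; lookup; last)
open import Function.Base using (id)
open import Level using (Level; 0ℓ; _⊔_) renaming (suc to lsuc)
open import Relation.Binary.Core using (Rel)
open import Relation.Binary.Definitions using (Symmetric; Irreflexive)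
open import Relation.Binary.PropositionalEquality using (_≡_; _≢_; refl; ≢-sym)
open import Relation.Nullary.Negation using (¬_)
open import Relation.Unary using (Pred; _∖_) renaming (_∈_ to _∈ₛ_)

data VrMV : Set where
  vr : ℕ → VrMV

data FmMV : Set where
  fm : ℕ → FmMV

MV : Set
MV = VrMV ⊎ FmMV

record Language (ℓ : Level) : Set (lsuc ℓ) where
  field
    Predicate : Set ℓ
    arity     : Predicate → ℕ

-- A subset of 𝒫₂(MV), given as the relation "{m , n} belongs to the set".
-- Irreflexivity says that its members really have two elements.
record PairSet : Set₁ where
  field
    Holds       : Rel MV 0ℓ
    symmetric   : Symmetric Holds
    irreflexive : Irreflexive _≡_ Holds

infix 4 _∋⟨_,_⟩ _⊆₂_ _≈₂_

_∋⟨_,_⟩ : PairSet → MV → MV → Set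
D ∋⟨ m , n ⟩ = PairSet.Holds D m n

_⊆₂_ : PairSet → PairSet → Set
D ⊆₂ E = ∀ {m n} → D ∋⟨ m , n ⟩ → E ∋⟨ m , n ⟩

_≈₂_ : PairSet → PairSet → Set
D ≈₂ E = D ⊆₂ E × E ⊆₂ D

-- {{m , n} ∈ 𝒫₂(MV) ∣ R m n}
pairs : Rel MV 0ℓ → PairSet
pairs R = record
  { Holds       = λ m n → m ≢ n × (R m n ⊎ R n m)
  ; symmetric   = λ (m≢n , r) → ≢-sym m≢n , Sum.swap r
  ; irreflexive = λ m≡n (m≢n , _) → m≢n m≡n
  }

infixr 6 _∪₂_

_∪₂_ : PairSet → PairSet → PairSet
D ∪₂ E = pairs (λ m n → D ∋⟨ m , n ⟩ ⊎ E ∋⟨ m , n ⟩)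

noDV : PairSet
noDV = pairs (λ _ _ → ⊥)

DV⟨_,_⟩ : MV → MV → PairSet
DV⟨ m , n ⟩ = pairs (λ m′ n′ → m′ ≡ m × n′ ≡ n)

module Schemes {ℓ : Level} (L : Language ℓ) where

  open Language L

  infix  9 _≐_
  infix  8 ∼_
  infixr 7 _⇒_

  data MF : Set ℓ where
    ⌜_⌝    : FmMV → MF
    _≐_    : VrMV → VrMV → MF
    atom   : (P : Predicate) → Vec VrMV (arity P) → MF
    forAll : VrMV → MF → MF
    ∼_     : MF → MF
    _⇒_    : MF → MF → MF

  -- Finite sets (of metavariables here, of hypotheses below) are lists, of
  -- which only the membership relation matters.
  OC : MF → List MV
  OC ⌜ p ⌝        = inj₂ p ∷ []
  OC (u ≐ v)      = inj₁ u ∷ inj₁ v ∷ []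
  OC (atom P us)  = map inj₁ (Vec.toList us)
  OC (forAll u Φ) = inj₁ u ∷ OC Φ
  OC (∼ Φ)        = OC Φ
  OC (Φ ⇒ Ψ)      = OC Φ ++ OC Ψ

  OCᵗ : VrMV ⊎ MF → List MV
  OCᵗ (inj₁ u) = inj₁ u ∷ []
  OCᵗ (inj₂ Φ) = OC Φ

  record Scheme : Set (lsuc 0ℓ ⊔ ℓ) where
    field
      hyps  : List MF
      concl : MF

    occ : List MV
    occ = concatMap OC hyps ++ OC concl

    field
      DV    : PairSet
      DV⊆OC : ∀ {m n} → DV ∋⟨ m , n ⟩ → m ∈ occ × n ∈ occ

  open Scheme public

  -- The scheme (Γ , Φ , D), where D is intersected with the pairs of
  -- metavariables occurring in Γ or Φ.
  scheme : List MF → MF → PairSet → Scheme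
  scheme Γ Φ D = record
    { hyps  = Γ
    ; concl = Φ
    ; DV    = record
      { Holds       = λ m n → D ∋⟨ m , n ⟩ × m ∈ O × n ∈ O
      ; symmetric   = λ (d , m∈O , n∈O) → PairSet.symmetric D d , n∈O , m∈O
      ; irreflexive = λ m≡n (d , _) → PairSet.irreflexive D m≡n d
      }
    ; DV⊆OC = λ (_ , m∈O , n∈O) → m∈O , n∈O
    }
    where
    O : List MV
    O = concatMap OC Γ ++ OC Φ

  infix 4 _≈_

  _≈_ : Scheme → Scheme → Set ℓ
  Φ ≈ Ψ = hyps Φ ∼[ set ] hyps Ψ × concl Φ ≡ concl Ψ × DV Φ ≈₂ DV Ψ

  -- The set {Φ}, with schemes compared by ≈ because _≡_ distinguishes lists
  -- and relations that represent the same set.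
  singleton : Scheme → Pred Scheme ℓ
  singleton Φ Ψ = Ψ ≈ Φ

  record Substitution : Set ℓ where
    field
      onVr : VrMV → VrMV
      onFm : FmMV → MF

    _at_ : MV → VrMV ⊎ MF
    _at_ = Sum.map onVr onFm

    field
      finiteSupport : ∃[ ms ] ∀ m → m ∉ ms → _at_ m ≡ Sum.map id ⌜_⌝ m

  open Substitution public

  infix 10 _[_] _[_]₂

  _[_] : MF → Substitution → MF
  ⌜ p ⌝      [ σ ] = onFm σ p
  (u ≐ v)    [ σ ] = onVr σ u ≐ onVr σ v
  atom P us  [ σ ] = atom P (Vec.map (onVr σ) us)
  forAll u Φ [ σ ] = forAll (onVr σ u) (Φ [ σ ])
  (∼ Φ)      [ σ ] = ∼ Φ [ σ ]
  (Φ ⇒ Ψ)    [ σ ] = Φ [ σ ] ⇒ Ψ [ σ ]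

  _[_]₂ : PairSet → Substitution → PairSet
  D [ σ ]₂ = pairs λ m n → ∃[ m′ ] ∃[ n′ ]
    D ∋⟨ m′ , n′ ⟩ × m ∈ OCᵗ (σ at m′) × n ∈ OCᵗ (σ at n′)

  Legitimate : Substitution → Scheme → Set
  Legitimate σ Φ = ∀ {m n} → DV Φ ∋⟨ m , n ⟩ → Disjoint (OCᵗ (σ at m)) (OCᵗ (σ at n))

  infix 4 _InstanceOf_

  _InstanceOf_ : Scheme → Scheme → Set ℓ
  Ψ InstanceOf Φ = ∃[ σ ]
      Legitimate σ Φ
    × hyps Ψ ∼[ set ] map (_[ σ ]) (hyps Φ)
    × concl Ψ ≡ concl Φ [ σ ]
    × DV Φ [ σ ]₂ ⊆₂ DV Ψ

  record Proof {s} (S : Pred Scheme s) (Φ : Scheme) : Set (lsuc 0ℓ ⊔ ℓ ⊔ s) where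
    field
      {k}      : ℕ
      lines    : Vec MF (suc k)
      lastLine : last lines ≡ concl Φ

    occₚ : List MV
    occₚ = concatMap OC (Vec.toList lines) ++ occ Φ

    DVₚ : PairSet
    DVₚ = DV Φ ∪₂ pairs (λ m n → (m ∈ occₚ × m ∉ occ Φ) × n ∈ occₚ)

    field
      justified : ∀ i → lookup lines i ∈ hyps Φ
        ⊎ (∃[ is ] All (_< i) is × ∃[ Ψ ] Ψ ∈ₛ S ×
             scheme (map (lookup lines) is) (lookup lines i) DVₚ InstanceOf Ψ)

  infix 4 _ProvableFrom_ _IndependentIn_

  _ProvableFrom_ : ∀ {s} → Scheme → Pred Scheme s → Set (lsuc 0ℓ ⊔ ℓ ⊔ s)
  Φ ProvableFrom S = Proof S Φ

  _IndependentIn_ : ∀ {s} → Scheme → Pred Scheme s → Set (lsuc 0ℓ ⊔ ℓ ⊔ s)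
  Φ IndependentIn S = Φ ∈ₛ S × ¬ (Φ ProvableFrom S ∖ singleton Φ)

  private
    x y z : VrMV
    x = vr 0
    y = vr 1
    z = vr 2

    φᵐ : FmMV
    φᵐ = fm 0

    φ ψ χ θ τ : MF
    φ = ⌜ φᵐ ⌝
    ψ = ⌜ fm 1 ⌝
    χ = ⌜ fm 2 ⌝
    θ = ⌜ fm 3 ⌝
    τ = ⌜ fm 4 ⌝

  mp minimp peirce contrap notelim gen ALLdistr spec modal5 vacGen ALLcomm
    EQrefl EQsymm EQtrans denot subst ALLeq genEq : Scheme

  mp       = scheme (φ ∷ (φ ⇒ ψ) ∷ []) ψ noDV
  minimp   = scheme [] (φ ⇒ (ψ ⇒ χ) ⇒ ((θ ⇒ ψ) ⇒ (χ ⇒ τ)) ⇒ (ψ ⇒ τ)) noDV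
  peirce   = scheme [] (((φ ⇒ ψ) ⇒ φ) ⇒ φ) noDV
  contrap  = scheme [] ((φ ⇒ ∼ ψ) ⇒ (ψ ⇒ ∼ φ)) noDV
  notelim  = scheme [] (∼ φ ⇒ (φ ⇒ ψ)) noDV
  gen      = scheme (φ ∷ []) (forAll x φ) noDV
  ALLdistr = scheme [] (forAll x (φ ⇒ ψ) ⇒ (forAll x φ ⇒ forAll x ψ)) noDV
  spec     = scheme [] (forAll x φ ⇒ φ) noDV
  modal5   = scheme [] (∼ forAll x φ ⇒ forAll x (∼ forAll x φ)) noDV
  vacGen   = scheme [] (φ ⇒ forAll x φ) DV⟨ inj₁ x , inj₂ φᵐ ⟩
  ALLcomm  = scheme [] (forAll x (forAll y φ) ⇒ forAll y (forAll x φ)) noDV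
  EQrefl   = scheme [] (x ≐ x) noDV
  EQsymm   = scheme [] (x ≐ y ⇒ y ≐ x) noDV
  EQtrans  = scheme [] (x ≐ y ⇒ (y ≐ z ⇒ x ≐ z)) noDV
  denot    = scheme [] (x ≐ x ⇒ ∼ forAll y (∼ (y ≐ x))) DV⟨ inj₁ x , inj₁ y ⟩
  subst    = scheme [] (forAll x (x ≐ y ⇒ (φ ⇒ forAll x (x ≐ y ⇒ φ))))
               (DV⟨ inj₁ x , inj₁ y ⟩ ∪₂ DV⟨ inj₁ y , inj₂ φᵐ ⟩)
  ALLeq    = scheme [] (forAll x (x ≐ y) ⇒ (forAll x φ ⇒ forAll y φ)) noDV
  genEq    = scheme [] (∼ forAll x (x ≐ y) ⇒ (∼ forAll x (x ≐ z) ⇒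
               (y ≐ z ⇒ forAll x (y ≐ z)))) noDV

  axioms : List Scheme
  axioms = mp ∷ minimp ∷ peirce ∷ contrap ∷ notelim ∷ gen ∷ ALLdistr ∷ spec ∷
    modal5 ∷ vacGen ∷ ALLcomm ∷ EQrefl ∷ EQsymm ∷ EQtrans ∷ denot ∷ subst ∷
    ALLeq ∷ genEq ∷ []

  TMM : Pred Scheme (lsuc 0ℓ ⊔ ℓ)
  TMM Ψ = ∃[ Φ ] Φ ∈ axioms × Ψ ≈ Φ

  specDV : Scheme
  specDV = scheme [] (forAll x φ ⇒ φ) DV⟨ inj₁ x , inj₂ φᵐ ⟩

{-# OPTIONS --safe #-}

-- The countermodel has an outer domain, in which variables take their values,
-- and a smaller inner domain, over which quantifiers range.  There are two inner
-- objects just b and one further value, nothing, which no quantifier reaches but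
-- which is ≡-equivalent to an inner object.  With φ read as "x lies in the inner domain", ∀x φ → φ fails,
-- whereas it holds when φ does not depend on x, the inner domain being nonempty.
-- The equality axioms survive because ≡ is an equivalence relation whose classes
-- each contain exactly one inner object, of which there are at least two.
module Submission where

open import Defs
open import Data.Bool.Base using (Bool; true; false; T)
open import Data.Bool.Properties as Bool using (T?)
open import Data.Fin.Base using (fromℕ; _<_)
open import Data.Fin.Induction using (<-wellFounded)
open import Data.List.Base using (List; _∷_; [])
open import Data.List.Membership.Propositional using (_∈_)
open import Data.List.Membership.Propositional.Properties
  using (∈-++⁺ˡ; ∈-++⁺ʳ; ∈-map⁺; ∈-map⁻)
open import Data.List.Relation.Unary.All as All using (All; []; _∷_)
open import Data.List.Relation.Unary.Any using (here; there)
open import Data.Maybe.Base using (Maybe; just; nothing; fromMaybe; is-just)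
open import Data.Nat.Base using (zero; suc)
open import Data.Nat.Properties as ℕ using ()
open import Data.Product.Base using (_×_; _,_; proj₁; proj₂)
open import Data.Sum.Base using (inj₁; inj₂)
open import Data.Unit.Base using (⊤; tt)
open import Data.Vec.Base using (Vec; lookup; last; _∷_; [])
open import Function.Base using (id; _∘_; const; case_of_)
open import Function.Bundles using (Equivalence; mk⇔)
open import Function.Properties.Equivalence using () renaming (trans to ⇔-trans)
import Induction.WellFounded as WF
open import Level using (Level; 0ℓ)
open import Relation.Binary.Definitions using (DecidableEquality)
open import Relation.Binary.PropositionalEquality
  using (_≡_; _≢_; refl; sym; trans; cong; subst; module ≡-Reasoning)
open import Relation.Nullary.Decidable using (yes; no; map′; decidable-stable)
open import Relation.Nullary.Negation using (¬_; contradiction; Stable; negated-stable)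
open import Relation.Unary using (Pred; _∪_; _∖_; _⊆′_)

infix 5 _≟_

_≟_ : DecidableEquality VrMV
vr i ≟ vr j = map′ (cong vr) (λ { refl → refl }) (i ℕ.≟ j)

lookup-last : ∀ {a} {A : Set a} {k} (xs : Vec A (suc k)) → last xs ≡ lookup xs (fromℕ k)
lookup-last (x ∷ [])     = refl
lookup-last (x ∷ y ∷ xs) = lookup-last (y ∷ xs)

-- Values and updates of valuations.

Value : Set
Value = Maybe Bool

-- The inner object equivalent to a value.
core : Value → Bool
core = fromMaybe false

Valuation : Set
Valuation = VrMV → Value

infixl 8 _⟨_≔_⟩

_⟨_≔_⟩ : Valuation → VrMV → Value → Valuation
(v ⟨ u ≔ a ⟩) w with u ≟ w
... | yes _ = a
... | no  _ = v w

module _ (v : Valuation) (a : Value) where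

  update-same : ∀ u → (v ⟨ u ≔ a ⟩) u ≡ a
  update-same u with u ≟ u
  ... | yes _   = refl
  ... | no  u≢u = contradiction refl u≢u

  update-other : ∀ {u w} → u ≢ w → (v ⟨ u ≔ a ⟩) w ≡ v w
  update-other {u} {w} u≢w with u ≟ w
  ... | yes u≡w = contradiction u≡w u≢w
  ... | no  _   = refl

update-cong : ∀ {v v′} u a {w} → v w ≡ v′ w → (v ⟨ u ≔ a ⟩) w ≡ (v′ ⟨ u ≔ a ⟩) w
update-cong u a {w} eq with u ≟ w
... | yes _ = refl
... | no  _ = eq

update-twice : ∀ v u a b w → (v ⟨ u ≔ a ⟩ ⟨ u ≔ b ⟩) w ≡ (v ⟨ u ≔ b ⟩) w
update-twice v u a b w with u ≟ w
... | yes _   = refl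
... | no  u≢w = update-other v a u≢w

update-comm : ∀ v {u w} → u ≢ w → ∀ a b t →
  (v ⟨ u ≔ a ⟩ ⟨ w ≔ b ⟩) t ≡ (v ⟨ w ≔ b ⟩ ⟨ u ≔ a ⟩) t
update-comm v {u} {w} u≢w a b t with u ≟ t | w ≟ t
... | yes refl | yes refl = contradiction refl u≢w
... | yes refl | no  _    = update-same v a u
... | no  _    | yes refl = sym (update-same v b w)
... | no  u≢t  | no  w≢t  = trans (update-other v a u≢t) (sym (update-other v b w≢t))

-- The interpretation of m in the countermodel can depend on the value of u.
data _Affects_ : VrMV → MV → Set where
  self : ∀ {u} → u Affects inj₁ u
  x-φ  : vr 0 Affects inj₂ (fm 0)

-- Satisfaction in the countermodel.

module Countermodel {ℓ : Level} (L : Language ℓ) where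

  open Schemes L hiding (subst)

  infix 3 _⊨_

  -- `fm 0` and `vr 0` are the `φ` and `x` of `spec`; other formula metavariables and atoms are
  -- simply true.
  _⊨_ : Valuation → MF → Set
  v ⊨ ⌜ fm zero ⌝    = T (is-just (v (vr 0)))
  v ⊨ ⌜ fm (suc _) ⌝ = ⊤
  v ⊨ u ≐ w          = core (v u) ≡ core (v w)
  v ⊨ atom P us      = ⊤
  v ⊨ forAll u Φ     = ∀ b → v ⟨ u ≔ just b ⟩ ⊨ Φ
  v ⊨ ∼ Φ            = ¬ (v ⊨ Φ)
  v ⊨ Φ ⇒ Ψ          = v ⊨ Φ → v ⊨ Ψ

  Valid : MF → Set
  Valid Φ = ∀ v → v ⊨ Φ

  -- Connectives are read constructively; stability supplies the classical reasoning for `peirce`.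
  ⊨-stable : ∀ Φ {v} → Stable (v ⊨ Φ)
  ⊨-stable ⌜ fm zero ⌝    = decidable-stable (T? _)
  ⊨-stable ⌜ fm (suc _) ⌝ = const tt
  ⊨-stable (u ≐ w)        = decidable-stable (_ Bool.≟ _)
  ⊨-stable (atom P us)    = const tt
  ⊨-stable (forAll u Φ) ¬¬h b = ⊨-stable Φ λ ¬h → ¬¬h λ h → ¬h (h b)
  ⊨-stable (∼ Φ)          = negated-stable
  ⊨-stable (Φ ⇒ Ψ) ¬¬h a  = ⊨-stable Ψ λ ¬b → ¬¬h λ h → ¬b (h a)

  -- Bound variables count as occurrences too, since disjoint variable conditions speak of `OC`.
  ⊨-coincidence : ∀ Φ {v v′} →
    (∀ {m u} → m ∈ OC Φ → u Affects m → v u ≡ v′ u) → v ⊨ Φ → v′ ⊨ Φ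
  ⊨-coincidence ⌜ fm zero ⌝    eq h = subst (T ∘ is-just) (eq (here refl) x-φ) h
  ⊨-coincidence ⌜ fm (suc _) ⌝ eq h = tt
  ⊨-coincidence (u ≐ w) {v} {v′} eq h = begin
    core (v′ u) ≡⟨ cong core (eq (here refl) self) ⟨
    core (v u)  ≡⟨ h ⟩
    core (v w)  ≡⟨ cong core (eq (there (here refl)) self) ⟩
    core (v′ w) ∎
    where open ≡-Reasoning
  ⊨-coincidence (atom P us)    eq h = tt
  ⊨-coincidence (forAll u Φ)   eq h b = ⊨-coincidence Φ
    (λ m∈ aff → update-cong u (just b) (eq (there m∈) aff)) (h b)
  ⊨-coincidence (∼ Φ)          eq h = h ∘ ⊨-coincidence Φ (λ m∈ aff → sym (eq m∈ aff))
  ⊨-coincidence (Φ ⇒ Ψ)        eq h =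
    ⊨-coincidence Ψ (λ m∈ → eq (∈-++⁺ʳ (OC Φ) m∈)) ∘ h ∘
    ⊨-coincidence Φ (λ m∈ aff → sym (eq (∈-++⁺ˡ m∈) aff))

  ⊨-cong : ∀ Φ {v v′} → (∀ u → v u ≡ v′ u) → v ⊨ Φ → v′ ⊨ Φ
  ⊨-cong Φ eq = ⊨-coincidence Φ (λ _ _ → eq _)

  infix 4 _#_

  -- Semantic freshness: against a single variable it means distinctness, against `OC Φ` that `u`
  -- cannot influence the truth of `Φ`.
  _#_ : VrMV → List MV → Set
  u # ms = ∀ {m} → m ∈ ms → ¬ (u Affects m)

  update-fresh : ∀ {u ms} → u # ms → ∀ v a {m w} → m ∈ ms → w Affects m →
    (v ⟨ u ≔ a ⟩) w ≡ v w
  update-fresh {u} u# v a {w = w} m∈ aff = update-other v a {u} {w} λ { refl → u# m∈ aff }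

  -- Validity of the axiom schemes.

  peirce-valid : ∀ Φ Ψ → Valid (((Φ ⇒ Ψ) ⇒ Φ) ⇒ Φ)
  peirce-valid Φ Ψ v h = ⊨-stable Φ λ ¬a → ¬a (h λ a → contradiction a ¬a)

  modal5-valid : ∀ u Φ → Valid (∼ forAll u Φ ⇒ forAll u (∼ forAll u Φ))
  modal5-valid u Φ v ¬h a h =
    -- Rebinding `u` erases the outer choice `a`.
    ¬h λ b → ⊨-cong Φ (update-twice v u (just a) (just b)) (h b)

  spec-valid : ∀ u Φ → u # OC Φ → Valid (forAll u Φ ⇒ Φ)
  -- `false` is an arbitrary inner object: all that matters is that one exists.
  spec-valid u Φ u# v h = ⊨-coincidence Φ (update-fresh u# v (just false)) (h false)

  vacGen-valid : ∀ u Φ → u # OC Φ → Valid (Φ ⇒ forAll u Φ)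
  vacGen-valid u Φ u# v h b =
    ⊨-coincidence Φ (λ m∈ aff → sym (update-fresh u# v (just b) m∈ aff)) h

  ALLcomm-valid : ∀ u w Φ → Valid (forAll u (forAll w Φ) ⇒ forAll w (forAll u Φ))
  ALLcomm-valid u w Φ v with u ≟ w
  ... | yes refl = id
  ... | no  u≢w  = λ h b a → ⊨-cong Φ (update-comm v u≢w (just a) (just b)) (h a b)

  denot-valid : ∀ u w → u ≢ w → Valid (u ≐ u ⇒ ∼ forAll w (∼ (w ≐ u)))
  -- The witness is the inner object in the class of `v u`, available even if `v u` is `nothing`.
  denot-valid u w u≢w v _ h = h (core (v u)) (begin
    core ((v ⟨ w ≔ a ⟩) w) ≡⟨ cong core (update-same v a w) ⟩
    core (v u)             ≡⟨ cong core (update-other v a (u≢w ∘ sym)) ⟨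
    core ((v ⟨ w ≔ a ⟩) u) ∎)
    where
    open ≡-Reasoning
    a : Value
    a = just (core (v u))

  ≐-update : ∀ {u w} → u ≢ w → ∀ v b → v ⟨ u ≔ just b ⟩ ⊨ u ≐ w → b ≡ core (v w)
  ≐-update {u} {w} u≢w v b h = begin
    b                           ≡⟨ cong core (update-same v (just b) u) ⟨
    core ((v ⟨ u ≔ just b ⟩) u) ≡⟨ h ⟩
    core ((v ⟨ u ≔ just b ⟩) w) ≡⟨ cong core (update-other v (just b) u≢w) ⟩
    core (v w)                  ∎
    where open ≡-Reasoning

  -- Both values of `u` are bound, hence inner, and a class has only one inner object. So `Φ` is
  -- never transferred between `nothing` and its inner equivalent, which it may tell apart.
  subst-valid : ∀ u w Φ → u ≢ w → Valid (forAll u (u ≐ w ⇒ (Φ ⇒ forAll u (u ≐ w ⇒ Φ))))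
  subst-valid u w Φ u≢w v b b≐w h c c≐w =
    subst (λ d → v ⟨ u ≔ just b ⟩ ⟨ u ≔ just d ⟩ ⊨ Φ) b≡c
      (⊨-cong Φ (λ t → sym (update-twice v u (just b) (just b) t)) h)
    where
    open ≡-Reasoning
    b≡c : b ≡ c
    b≡c = begin
      b                           ≡⟨ ≐-update u≢w v b b≐w ⟩
      core (v w)                  ≡⟨ cong core (update-other v (just b) u≢w) ⟨
      core ((v ⟨ u ≔ just b ⟩) w) ≡⟨ ≐-update u≢w (v ⟨ u ≔ just b ⟩) c c≐w ⟨
      c                           ∎

  ALLeq-valid : ∀ u w Φ → Valid (forAll u (u ≐ w) ⇒ (forAll u Φ ⇒ forAll w Φ))
  ALLeq-valid u w Φ v eq = case u ≟ w of λ where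
    (yes refl) → id
    -- The value of `w` would have to be equivalent to both inner objects.
    (no  u≢w)  → contradiction
      (trans (≐-update u≢w v true (eq true)) (sym (≐-update u≢w v false (eq false)))) λ ()

  genEq-valid : ∀ u w t →
    Valid (∼ forAll u (u ≐ w) ⇒ (∼ forAll u (u ≐ t) ⇒ (w ≐ t ⇒ forAll u (w ≐ t))))
  genEq-valid u w t v ¬u≐w ¬u≐t w≐t b = let open ≡-Reasoning in case (u ≟ w , u ≟ t) of λ where
    -- If `u` is `w` or `t`, a premise denies reflexivity; otherwise `w ≐ t` does not depend on `u`.
    (yes refl , _)        → contradiction (λ _ → refl) ¬u≐w
    (no _     , yes refl) → contradiction (λ _ → refl) ¬u≐t
    (no u≢w   , no u≢t)   → begin
      core ((v ⟨ u ≔ just b ⟩) w) ≡⟨ cong core (update-other v (just b) u≢w) ⟩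
      core (v w)                  ≡⟨ w≐t ⟩
      core (v t)                  ≡⟨ cong core (update-other v (just b) u≢t) ⟨
      core ((v ⟨ u ≔ just b ⟩) t) ∎

  -- Soundness of schemes.

  x y z : Substitution → VrMV
  x σ = onVr σ (vr 0)
  y σ = onVr σ (vr 1)
  z σ = onVr σ (vr 2)

  φ ψ : Substitution → MF
  φ σ = onFm σ (fm 0)
  ψ σ = onFm σ (fm 1)

  -- The meaning that the countermodel gives to disjoint variable conditions.
  Respects : Substitution → Scheme → Set
  Respects σ Φ = ∀ {u n} → DV Φ ∋⟨ inj₁ u , n ⟩ → onVr σ u # OCᵗ (σ at n)

  -- Hypotheses must hold at all valuations, as `gen` requires.
  Sound : Scheme → Set ℓ
  Sound Φ = ∀ σ → Respects σ Φ →
    (∀ {Ψ} → Ψ ∈ hyps Φ → Valid (Ψ [ σ ])) → Valid (concl Φ [ σ ])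

  Sound-resp-≈ : ∀ Φ Ψ → Ψ ≈ Φ → Sound Φ → Sound Ψ
  Sound-resp-≈ Φ Ψ (hyps∼ , concl≡ , _ , DVΦ⊆DVΨ) sound σ resp valid =
    subst (λ Χ → Valid (Χ [ σ ])) (sym concl≡)
      (sound σ (resp ∘ DVΦ⊆DVΨ) (λ Χ∈ → valid (Equivalence.from hyps∼ Χ∈)))

  ≈-refl : ∀ Φ → Φ ≈ Φ
  ≈-refl Φ = mk⇔ id id , refl , id , id

  ≈-trans : ∀ Φ Ψ Χ → Φ ≈ Ψ → Ψ ≈ Χ → Φ ≈ Χ
  ≈-trans Φ Ψ Χ (h , c , d , d′) (h′ , c′ , e , e′) =
    ⇔-trans h h′ , trans c c′ , (λ p → e (d p)) , (λ p → d′ (e′ p))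

  specDV-sound : Sound specDV
  specDV-sound σ resp _ = spec-valid (x σ) (φ σ)
    (resp (((λ ()) , inj₁ (refl , refl)) , here refl , there (here refl)))

  axioms-sound : All (λ Φ → ¬ Φ ≈ spec → Sound Φ) axioms
  axioms-sound =
      (λ _ σ _ h v → h (there (here refl)) v (h (here refl) v))
    ∷ (λ _ σ _ _ v a b c d → c (const d) (b d))
    ∷ (λ _ σ _ _ → peirce-valid (φ σ) (ψ σ))
    ∷ (λ _ σ _ _ v h b a → h a b)
    ∷ (λ _ σ _ _ v ¬a a → contradiction a ¬a)
    ∷ (λ _ σ _ h v b → h (here refl) _)
    ∷ (λ _ σ _ _ v h h′ b → h b (h′ b))
    ∷ (λ ≉spec → contradiction (≈-refl spec) ≉spec)
    ∷ (λ _ σ _ _ → modal5-valid (x σ) (φ σ))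
    ∷ (λ _ σ resp _ → vacGen-valid (x σ) (φ σ)
        (resp (((λ ()) , inj₁ (refl , refl)) , there (here refl) , here refl)))
    ∷ (λ _ σ _ _ → ALLcomm-valid (x σ) (y σ) (φ σ))
    ∷ (λ _ σ _ _ v → refl)
    ∷ (λ _ σ _ _ v → sym)
    ∷ (λ _ σ _ _ v → trans)
    ∷ (λ _ σ resp _ → denot-valid (x σ) (y σ) (#⇒≢
        (resp (((λ ()) , inj₁ (refl , refl)) , here refl , there (there (there (here refl)))))))
    ∷ (λ _ σ resp _ → subst-valid (x σ) (y σ) (φ σ) (#⇒≢
        (resp (((λ ()) , inj₁ (inj₁ ((λ ()) , inj₁ (refl , refl)))) ,
          here refl , there (there (here refl))))))
    ∷ (λ _ σ _ _ → ALLeq-valid (x σ) (y σ) (φ σ))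
    ∷ (λ _ σ _ _ → genEq-valid (x σ) (y σ) (z σ))
    ∷ []
    where
    #⇒≢ : ∀ {u w} → u # inj₁ w ∷ [] → u ≢ w
    #⇒≢ u# refl = u# (here refl) self

  weakened-sound : (TMM ∖ singleton spec) ∪ singleton specDV ⊆′ Sound
  -- The exclusion of `spec` passes from `Ψ` to the listed axiom that it represents.
  weakened-sound Ψ (inj₁ ((Φ , Φ∈ , Ψ≈Φ) , Ψ≉spec)) = Sound-resp-≈ Φ Ψ Ψ≈Φ
    (All.lookup axioms-sound Φ∈ λ Φ≈spec → Ψ≉spec (≈-trans Ψ Φ spec Ψ≈Φ Φ≈spec))
  weakened-sound Ψ (inj₂ Ψ≈specDV) = Sound-resp-≈ specDV Ψ Ψ≈specDV specDV-sound

  -- Validity of the lines of a proof of `spec`.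

  module _ {s} {S : Pred Scheme s} (S-sound : S ⊆′ Sound) (P : Proof S spec) where

    open Proof P

    -- `spec` has no conditions of its own, and those added by the proof involve a metavariable
    -- outside `spec`. Hence `x` and `φ` are never paired.
    DVₚ-unaffected : ∀ {u m} → DVₚ ∋⟨ inj₁ u , m ⟩ → ¬ (u Affects m)
    DVₚ-unaffected dv self = PairSet.irreflexive DVₚ refl dv
    DVₚ-unaffected (_ , inj₁ (inj₁ ((_ , inj₁ ()) , _))) x-φ
    DVₚ-unaffected (_ , inj₁ (inj₁ ((_ , inj₂ ()) , _))) x-φ
    DVₚ-unaffected (_ , inj₁ (inj₂ (_ , inj₁ ((_ , x∉) , _)))) x-φ = x∉ (here refl)
    DVₚ-unaffected (_ , inj₁ (inj₂ (_ , inj₂ ((_ , φ∉) , _)))) x-φ = φ∉ (there (here refl))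
    DVₚ-unaffected (_ , inj₂ (inj₁ ((_ , inj₁ ()) , _))) x-φ
    DVₚ-unaffected (_ , inj₂ (inj₁ ((_ , inj₂ ()) , _))) x-φ
    DVₚ-unaffected (_ , inj₂ (inj₂ (_ , inj₁ ((_ , φ∉) , _)))) x-φ = φ∉ (there (here refl))
    DVₚ-unaffected (_ , inj₂ (inj₂ (_ , inj₂ ((_ , x∉) , _)))) x-φ = x∉ (here refl)

    line-valid : ∀ i → Valid (lookup lines i)
    line-valid = wfRec (λ i → Valid (lookup lines i)) step
      where
      open WF.All <-wellFounded 0ℓ using (wfRec)
      step : ∀ i → (∀ {j} → j < i → Valid (lookup lines j)) → Valid (lookup lines i)
      step i ih with justified i
      -- `spec` has no hypotheses, so every line comes from a rule.
      ... | inj₂ (is , is<i , Ψ , Ψ∈S , σ , legit , hyps∼ , concl≡ , DV⊆) =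
        subst Valid (sym concl≡) (S-sound Ψ Ψ∈S σ resp hyps-valid)
        where
        resp : Respects σ Ψ
        -- Legitimacy makes the two metavariables distinct, so that they form a pair of
        -- `DV Ψ [ σ ]₂` and thus of `DVₚ`.
        resp dv m∈ aff = DVₚ-unaffected (proj₁ (DV⊆ (u≢m , inj₁ (_ , _ , dv , here refl , m∈)))) aff
          where
          u≢m : _ ≢ _
          u≢m refl = legit dv (here refl , m∈)
        hyps-valid : ∀ {Φ} → Φ ∈ hyps Ψ → Valid (Φ [ σ ])
        hyps-valid Φ∈ with ∈-map⁻ (lookup lines) (Equivalence.from hyps∼ (∈-map⁺ (_[ σ ]) Φ∈))
        ... | j , j∈is , Φσ≡ = subst Valid (sym Φσ≡) (ih (All.lookup is<i j∈is))

  spec-not-provable : ∀ {s} {S : Pred Scheme s} → S ⊆′ Sound → ¬ spec ProvableFrom S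
  -- With `x` sent to `nothing`, `φ` fails, but the quantifier resets `x` to an inner object, where
  -- `φ` holds.
  spec-not-provable S-sound P = last-valid (const nothing) (const tt)
    where
    open Proof P
    last-valid : Valid (concl spec)
    last-valid = subst Valid (trans (sym (lookup-last lines)) lastLine)
      (line-valid S-sound P (fromℕ k))

proposition3p11 : ∀ {ℓ : Level} (L : Language ℓ) → let open Schemes L in
    ¬ (spec ProvableFrom (TMM ∖ singleton spec) ∪ singleton specDV)
    × spec IndependentIn TMM
proposition3p11 L =
    spec-not-provable weakened-sound
  , (spec , spec∈axioms , ≈-refl spec)
  , spec-not-provable (λ Ψ → weakened-sound Ψ ∘ inj₁)
  where
  open Schemes L
  open Countermodel L
  spec∈axioms : spec ∈ axioms
  spec∈axioms = there (there (there (there (there (there (there (here refl)))))))
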